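{- $\vec{C}_3(1,2,2)$ is not a hero in oriented complete multipartite graphs.
   Context: An oriented complete multipartite graph is an orientation (each edge given exactly one direction) of a complete multipartite graph. The dichromatic number $\vec{\chi}(D)$ is the least number of parts in a partition of $V(D)$ into sets inducing acyclic subdigraphs. A digraph $H$ is a hero in a class $\mathcal{C}$ if there is a constant $c$ such that every digraph in $\mathcal{C}$ with no induced subdigraph isomorphic to $H$ has dichromatic number at most $c$. For digraphs $D_1,D_2,D_3$, $\vec{C}_3(D_1,D_2,D_3)$ is the digraph obtained from their disjoint union by adding all arcs from $D_1$ to $D_2$, from $D_2$ to $D_3$ and from $D_3$ to $D_1$; an integer $k$ in this notation stands for the transitive tournament $TT_k$ on $k$ vertices. Thus $\vec{C}_3(1,2,2)$ is the 5-vertex tournament with vertices $x, y_1,y_2,z_1,z_2$ and arcs $y_1y_2$, $z_1z_2$, $xy_i$, $y_iz_j$, $z_jx$ for all $i,j\in\{1,2\}$. -}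

module Defs where

open import Data.Nat using (ℕ; zero; suc; _+_; _<ᵇ_)
open import Data.Fin using (Fin; zero; suc; toℕ; inject₁; fromℕ; splitAt)
open import Data.Bool using (Bool; true; false)
open import Data.Sum using (_⊎_; inj₁; inj₂)
open import Data.Product using (Σ; _×_; ∃)
open import Relation.Binary.PropositionalEquality using (_≡_; _≢_)
open import Relation.Nullary using (¬_)
open import Function.Definitions using (Injective)

record Digraph : Set where
  field
    n   : ℕ
    arc : Fin n → Fin n → Bool
open Digraph public

OrientedCompleteMultipartite : Digraph → Set
OrientedCompleteMultipartite D =
  Σ ℕ λ k → Σ (Fin (n D) → Fin k) λ p →
    ∀ u v →
      (p u ≡ p v → arc D u v ≡ false) ×
      (p u ≢ p v →
        (arc D u v ≡ true × arc D v u ≡ false) ⊎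
        (arc D u v ≡ false × arc D v u ≡ true))

record DirectedCycle (D : Digraph) : Set where
  field
    len   : ℕ
    vtx   : Fin (suc len) → Fin (n D)
    inj   : Injective _≡_ _≡_ vtx
    step  : ∀ (i : Fin len) → arc D (vtx (inject₁ i)) (vtx (suc i)) ≡ true
    close : arc D (vtx (fromℕ len)) (vtx zero) ≡ true
open DirectedCycle public

-- A colouring with c colours whose colour classes all induce acyclic
-- subdigraphs: no directed cycle is monochromatic.  So
-- DichromaticAtMost D c  ⇔  dichromatic number of D is ≤ c.
DichromaticAtMost : Digraph → ℕ → Set
DichromaticAtMost D c =
  Σ (Fin (n D) → Fin c) λ col →
    ∀ (C : DirectedCycle D) → ¬ (Σ (Fin c) λ j → ∀ i → col (vtx C i) ≡ j)

ContainsInduced : Digraph → Digraph → Set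
ContainsInduced D H =
  Σ (Fin (n H) → Fin (n D)) λ φ →
    Injective _≡_ _≡_ φ × (∀ u v → arc H u v ≡ arc D (φ u) (φ v))

Hero : (Digraph → Set) → Digraph → Set
Hero 𝒞 H =
  Σ ℕ λ c → ∀ (D : Digraph) → 𝒞 D → ¬ ContainsInduced D H → DichromaticAtMost D c

TT : ℕ → Digraph
TT k = record { n = k ; arc = λ i j → toℕ i <ᵇ toℕ j }

private
  Part : Digraph → Digraph → Digraph → Set
  Part D₁ D₂ D₃ = Fin (n D₁) ⊎ (Fin (n D₂) ⊎ Fin (n D₃))

  which : (D₁ D₂ D₃ : Digraph) → Fin (n D₁ + (n D₂ + n D₃)) → Part D₁ D₂ D₃
  which D₁ D₂ D₃ u with splitAt (n D₁) u
  ... | inj₁ a = inj₁ a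
  ... | inj₂ b = inj₂ (splitAt (n D₂) b)

  arcPart : (D₁ D₂ D₃ : Digraph) → Part D₁ D₂ D₃ → Part D₁ D₂ D₃ → Bool
  arcPart D₁ D₂ D₃ (inj₁ a)        (inj₁ b)        = arc D₁ a b
  arcPart D₁ D₂ D₃ (inj₂ (inj₁ a)) (inj₂ (inj₁ b)) = arc D₂ a b
  arcPart D₁ D₂ D₃ (inj₂ (inj₂ a)) (inj₂ (inj₂ b)) = arc D₃ a b
  arcPart D₁ D₂ D₃ (inj₁ _)        (inj₂ (inj₁ _)) = true
  arcPart D₁ D₂ D₃ (inj₂ (inj₁ _)) (inj₂ (inj₂ _)) = true
  arcPart D₁ D₂ D₃ (inj₂ (inj₂ _)) (inj₁ _)        = true
  arcPart D₁ D₂ D₃ _               _               = false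

C⃗₃ : Digraph → Digraph → Digraph → Digraph
C⃗₃ D₁ D₂ D₃ = record
  { n   = n D₁ + (n D₂ + n D₃)
  ; arc = λ u v → arcPart D₁ D₂ D₃ (which D₁ D₂ D₃ u) (which D₁ D₂ D₃ v) }

{-# OPTIONS --safe #-}
module Submission where

-- Let two players build a sequence of vertices: Builder presents a vertex, Painter colours it.
-- Every strategy of Builder against c colours yields a finite digraph on the tree of all plays,
-- ordered lexicographically: arcs go forward, except that a vertex w sends arcs back to selected
-- earlier vertices of its own play.  The selection works like a stack: w selects vertices that it
-- also pops, all of them in one part, and all vertices that select a given v lie in one part.
-- These two rules exclude C⃗₃(1,2,2): each of the four cyclic triangles x → yᵢ → zⱼ → x needs a
-- backward arc, which forces backward arcs x → y, z → x and y′ → z′ with y < z′ < x < y′ < z;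
-- but then y′ selects z′ although x has popped it.
--
-- Builder forces a monochromatic triangle.  Vertices carry a part j and a label i < j (the part of
-- the vertices that may select them).  S j i is the set of colours of the unpopped vertices of
-- part j and label i that were repeated later, in a fresh part; the repetition is forced by
-- playing recursively with fewer colours.  As S takes at most 2^c values, among many parts there
-- are i < j < k with S k j ≡ S j i.  Builder then presents w of part j and label i selecting the
-- vertices of part k and label j, popping everything above part j.  A colour of w in S k j closes
-- a triangle, any other colour enlarges S j i.  This makes lexicographic progress.

open import Defs
open import Data.Bool using (true; false)
open import Data.Empty using (⊥; ⊥-elim)
open import Data.Fin using (Fin; zero; suc; toℕ; inject₁; fromℕ<; combine; funToFin; finToFun)
import Data.Fin as Fin
import Data.Fin.Properties as Fin
open import Data.Fin.Patterns using (0F; 1F; 2F; 3F; 4F)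
open import Data.Fin.Subset using (Subset; ⁅_⁆; _∪_; _-_; _⊂_; _⊃_) renaming (_∈_ to _∈ₛ_; _∉_ to _∉ₛ_)
import Data.Fin.Subset as Subset
import Data.Fin.Subset.Properties as Subset
open import Data.Fin.Subset.Induction using (⊂-wellFounded; ⊃-wellFounded)
open import Data.List using (List; []; _∷_; _++_; _∷ʳ_; length; take; lookup; map; concatMap; allFin)
import Data.List.Properties as List
open import Data.List.Extrema.Nat using (max; xs≤max)
open import Data.List.Membership.Propositional using (_∈_)
open import Data.List.Membership.Propositional.Properties using (∈-map⁺; ∈-concat⁺′; ∈-allFin; ∈-lookup)
open import Data.List.Relation.Binary.Lex.Core using (halt; this; next)
open import Data.List.Relation.Binary.Lex.Strict
  using (Lex-<; <-compare; <-transitive; <-irreflexive; <-decidable)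
open import Data.List.Relation.Binary.Pointwise using (Pointwise-≡⇒≡; ≡⇒Pointwise-≡)
import Data.List.Relation.Unary.All as All
open import Data.List.Relation.Unary.Any as Any using (index)
open import Data.List.Relation.Unary.Any.Properties using (lookup-index)
open import Data.Nat using (ℕ; zero; suc; _+_; _*_; _^_; _≤_; _<_; z≤n; s≤s; _≟_; _≤?_; _<?_)
open import Data.Nat.Properties
  using (≤-refl; ≤-trans; ≤-reflexive; <-trans; <-asym; <-irrefl; <-≤-trans; <⇒≤; <⇒≢; n≤1+n; m≤m+n; m≤n⇒m≤1+n;
         m≤n⇒m<n∨m≡n; m≤n⇒m⊓n≡m; +-identityʳ; +-suc; +-cancelˡ-≡; +-monoʳ-<; allUpTo?)
open import Data.Product using (Σ; ∃; _×_; _,_; proj₁; proj₂)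
open import Data.Sum using (_⊎_; inj₁; inj₂)
open import Function using (_∘_)
open import Induction.WellFounded using (Acc; acc)
open import Relation.Binary using (tri<; tri≈; tri>)
open import Relation.Binary.PropositionalEquality
  using (_≡_; _≢_; refl; sym; trans; cong; subst; subst₂; resp₂; isEquivalence)
open import Relation.Nullary using (¬_; Dec; yes; no; does)
open import Relation.Nullary.Decidable using (_×-dec_; _→-dec_; ¬?; dec-true; dec-false)

-- Predicates as numbers and a pigeonhole principle.

does-true : ∀ {P : Set} (P? : Dec P) → does P? ≡ true → P
does-true (yes p) _ = p

indicator : ∀ {P : Set} → Dec P → Fin 2
indicator (yes _) = 1F
indicator (no _)  = 0F

indicator-≡ : ∀ {P Q : Set} (P? : Dec P) (Q? : Dec Q) → indicator P? ≡ indicator Q? → P → Q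
indicator-≡ P?      (yes q) _  _ = q
indicator-≡ (no ¬p) (no _)  _  p = ⊥-elim (¬p p)
indicator-≡ (yes _) (no _)  () _

code : ∀ {n} {P : Fin n → Set} → (∀ x → Dec (P x)) → Fin (2 ^ n)
code P? = funToFin (indicator ∘ P?)

code-≡ : ∀ {n} {P Q : Fin n → Set} (P? : ∀ x → Dec (P x)) (Q? : ∀ x → Dec (Q x)) →
         code P? ≡ code Q? → ∀ x → P x → Q x
code-≡ P? Q? eq x = indicator-≡ (P? x) (Q? x)
  (trans (sym (Fin.finToFun-funToFin (indicator ∘ P?) x))
    (trans (cong (λ k → finToFun k x) eq) (Fin.finToFun-funToFin (indicator ∘ Q?) x)))

-- Give each `j` the set of values `S j i` with `i < j`. Two of these sets agree, say for `j < k`;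
-- as `S k j` lies in that of `k`, it lies in that of `j`. This is the colouring bound for shift
-- graphs.
monochromatic-path : ∀ {m l} → 2 ^ l < m → (S : Fin m → Fin m → Fin l) →
  ∃ λ i → ∃ λ j → ∃ λ k → i Fin.< j × j Fin.< k × S k j ≡ S j i
monochromatic-path {m} {l} 2^l<m S with Fin.pigeonhole 2^l<m (λ j → code (used? j))
  module Path where
  Used : Fin m → Fin l → Set
  Used j s = ∃ λ i → i Fin.< j × S j i ≡ s

  used? : ∀ j s → Dec (Used j s)
  used? j s = Fin.any? λ i → (i Fin.<? j) ×-dec (S j i Fin.≟ s)
... | j , k , j<k , eq
  with i , i<j , Sji≡ ← code-≡ (Path.used? 2^l<m S k) (Path.used? 2^l<m S j) (sym eq) (S k j) (j , j<k , refl)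
  = i , j , k , i<j , j<k , sym Sji≡

-- A vertex w labelled m selects the vertices v of its play with part v ≡ target m, lab v ≡ part m
-- and time at least base m, unless v was popped by a vertex x between v and w, that is, unless
-- base x ≤ time v.  The time of a vertex is its number of predecessors in the play.
record Label : Set where
  constructor lbl
  field
    part lab target base : ℕ
open Label public

-- Plays as lists in lexicographic order.

module _ {c : ℕ} where

  infix 4 _≺_ _≺?_

  _≺_ : List (Fin c) → List (Fin c) → Set
  _≺_ = Lex-< _≡_ Fin._<_

  _≺?_ : ∀ u v → Dec (u ≺ v)
  _≺?_ = <-decidable Fin._≟_ Fin._<?_

  ≺-trans : ∀ {u v w} → u ≺ v → v ≺ w → u ≺ w
  ≺-trans = <-transitive isEquivalence (resp₂ Fin._<_) Fin.<-trans

  ≺-irrefl : ∀ {u} → ¬ u ≺ u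
  ≺-irrefl = <-irreflexive Fin.<-irrefl (≡⇒Pointwise-≡ refl)

  ≺-connex : ∀ u v → u ≢ v → u ≺ v ⊎ v ≺ u
  ≺-connex u v u≢v with <-compare sym Fin.<-cmp u v
  ... | tri< u≺v _ _ = inj₁ u≺v
  ... | tri≈ _ u≋v _ = ⊥-elim (u≢v (Pointwise-≡⇒≡ u≋v))
  ... | tri> _ _ v≺u = inj₂ v≺u

  Prefix : List (Fin c) → List (Fin c) → Set
  Prefix u v = u ≡ take (length u) v

  -- The order is the depth-first preorder of the tree, in which `u` and its descendants form an
  -- interval.
  prefix-convex : ∀ {u v w} → Prefix u w → u ≺ v → v ≺ w → Prefix u v
  prefix-convex {[]} _ _ _ = refl
  prefix-convex {x ∷ u} {y ∷ v} {z ∷ w} p (this x<y) (this y<z) =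
    ⊥-elim (Fin.<-irrefl (List.∷-injectiveˡ p) (Fin.<-trans x<y y<z))
  prefix-convex {x ∷ u} {y ∷ v} {z ∷ w} p (this x<y) (next refl _) =
    ⊥-elim (Fin.<-irrefl (List.∷-injectiveˡ p) x<y)
  prefix-convex {x ∷ u} {y ∷ v} {z ∷ w} p (next refl _) (this y<z) =
    ⊥-elim (Fin.<-irrefl (List.∷-injectiveˡ p) y<z)
  prefix-convex {x ∷ u} {y ∷ v} {z ∷ w} p (next refl u≺v) (next refl v≺w) =
    cong (x ∷_) (prefix-convex (List.∷-injectiveʳ p) u≺v v≺w)

  prefix-length-< : ∀ {u v w} → Prefix u w → Prefix v w → u ≺ v → length u < length v
  prefix-length-< {[]} {x ∷ v} _ _ halt = s≤s z≤n
  prefix-length-< {x ∷ u} {y ∷ v} {z ∷ w} p q (this x<y) =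
    ⊥-elim (Fin.<-irrefl (trans (List.∷-injectiveˡ p) (sym (List.∷-injectiveˡ q))) x<y)
  prefix-length-< {x ∷ u} {y ∷ v} {z ∷ w} p q (next _ u≺v) =
    s≤s (prefix-length-< (List.∷-injectiveʳ p) (List.∷-injectiveʳ q) u≺v)

  prefix-refl : ∀ u → Prefix u u
  prefix-refl u = sym (List.take-all (length u) u ≤-refl)

  take-≺ : ∀ {h m n} → m < n → m < length h → take m h ≺ take n h
  take-≺ {x ∷ h} {zero}  {suc n} _         _         = halt
  take-≺ {x ∷ h} {suc m} {suc n} (s≤s m<n) (s≤s m<h) = next refl (take-≺ m<n m<h)

  -- The digraph of a labelled tree and its forbidden subdigraph.

  module Multipartite (label : List (Fin c) → Label) where

    Back : List (Fin c) → List (Fin c) → Set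
    Back v w =
      Prefix v w × length v < length w ×
      part (label v) ≡ target (label w) × lab (label v) ≡ part (label w) ×
      base (label w) ≤ length v ×
      (∀ {n} → n < length w → length v < n → length v < base (label (take n w)))

    back? : ∀ v w → Dec (Back v w)
    back? v w =
      (List.≡-dec Fin._≟_ _ _) ×-dec (_ <? _) ×-dec (_ ≟ _) ×-dec (_ ≟ _) ×-dec (_ ≤? _) ×-dec
      allUpTo? (λ n → (length v <? n) →-dec (length v <? base (label (take n w)))) (length w)

    Part : List (Fin c) → ℕ
    Part v = part (label v)

    data Arc (u v : List (Fin c)) : Set where
      fwd : u ≺ v → ¬ Back u v → Arc u v
      bwd : v ≺ u → Back v u → Arc u v

    arc? : ∀ u v → Dec (Arc u v)
    arc? u v with u ≺? v | v ≺? u | back? u v | back? v u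
    ... | yes u≺v | _       | no ¬b | _     = yes (fwd u≺v ¬b)
    ... | yes u≺v | _       | yes b | _     =
      no λ { (fwd _ ¬b) → ¬b b ; (bwd v≺u _) → ≺-irrefl (≺-trans u≺v v≺u) }
    ... | no _    | yes v≺u | _     | yes b = yes (bwd v≺u b)
    ... | no u⊀v  | _       | _     | no ¬b = no λ { (fwd u≺v _) → u⊀v u≺v ; (bwd _ b) → ¬b b }
    ... | no u⊀v  | no v⊀u  | _     | _     = no λ { (fwd u≺v _) → u⊀v u≺v ; (bwd v≺u _) → v⊀u v≺u }

    Arc-connex : ∀ u v → u ≢ v → Arc u v ⊎ Arc v u
    Arc-connex u v u≢v with ≺-connex u v u≢v | back? u v | back? v u
    ... | inj₁ u≺v | no ¬b | _     = inj₁ (fwd u≺v ¬b)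
    ... | inj₁ u≺v | yes b | _     = inj₂ (bwd u≺v b)
    ... | inj₂ v≺u | _     | no ¬b = inj₂ (fwd v≺u ¬b)
    ... | inj₂ v≺u | _     | yes b = inj₁ (bwd v≺u b)

    Arc-asym : ∀ {u v} → Arc u v → ¬ Arc v u
    Arc-asym (fwd u≺v _) (fwd v≺u _) = ≺-irrefl (≺-trans u≺v v≺u)
    Arc-asym (fwd _ ¬b)  (bwd _ b)   = ¬b b
    Arc-asym (bwd _ b)   (fwd _ ¬b)  = ¬b b
    Arc-asym (bwd v≺u _) (bwd u≺v _) = ≺-irrefl (≺-trans u≺v v≺u)

    -- `Arc` is a tournament on all lists; only the arcs inside a part are dropped.
    _⟶_ : List (Fin c) → List (Fin c) → Set
    u ⟶ v = Part u ≢ Part v × Arc u v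

    _⟶?_ : ∀ u v → Dec (u ⟶ v)
    u ⟶? v = ¬? (Part u ≟ Part v) ×-dec arc? u v

    -- As `x` selects `e`, its base is at most the time of `e`. By convexity `e` is an ancestor of
    -- `y`, so `x` pops `y`; also by convexity `x` lies on the play of `b`, so `b` cannot select
    -- `y`.
    Back-no-crossing : ∀ {e y x b a} → Back e x → Back x a → Back y b →
                       e ≺ y → y ≺ x → x ≺ b → b ≺ a → ⊥
    Back-no-crossing {e} {y} {x} {b} {a} (pex , _ , _ , _ , base≤ , _) (pxa , _) (pyb , _ , _ , _ , _ , alive)
                     e≺y y≺x x≺b b≺a =
      <-irrefl refl (<-trans (prefix-length-< (prefix-convex pex e≺y y≺x) (prefix-refl y) e≺y)
                             (<-≤-trans y<base base≤))
      where
      pxb = prefix-convex pxa x≺b b≺a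
      y<base : length y < base (label x)
      y<base = subst (λ v → length y < base (label v)) (sym pxb)
        (alive (prefix-length-< pxb (prefix-refl b) x≺b) (prefix-length-< pyb pxb y≺x))

    Back-source-part : ∀ {v v′ w} → Back v w → Back v′ w → Part v ≡ Part v′
    Back-source-part (_ , _ , p , _) (_ , _ , p′ , _) = trans p (sym p′)

    Back-target-part : ∀ {v w w′} → Back v w → Back v w′ → Part w ≡ Part w′
    Back-target-part (_ , _ , _ , q , _) (_ , _ , _ , q′ , _) = trans (sym q) q′

    -- The two rules on parts make x → y′ and z′ → x forward, so y′ → z′ is backward. The same rules
    -- then make y → z′ and y′ → z forward, which leaves the order that `Back-no-crossing` forbids.
    no-opposite-backward : ∀ {x y y′ z z′} → Part y ≢ Part y′ → Part z ≢ Part z′ →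
                           y ≺ x → Back y x → x ≺ z → Back x z →
                           Arc x y′ → Arc z′ x → Arc y z′ → Arc y′ z → Arc y′ z′ → ⊥
    no-opposite-backward y≢ z≢ y≺x Byx x≺z Bxz (bwd _ By′x) _ _ _ _ = y≢ (Back-source-part Byx By′x)
    no-opposite-backward y≢ z≢ y≺x Byx x≺z Bxz (fwd _ _) (bwd _ Bxz′) _ _ _ =
      z≢ (Back-target-part Bxz Bxz′)
    no-opposite-backward y≢ z≢ y≺x Byx x≺z Bxz (fwd x≺y′ _) (fwd z′≺x _) _ _ (fwd y′≺z′ _) =
      ≺-irrefl (≺-trans x≺y′ (≺-trans y′≺z′ z′≺x))
    no-opposite-backward y≢ z≢ y≺x Byx x≺z Bxz (fwd x≺y′ _) (fwd z′≺x _) (bwd _ Bz′y) _ (bwd _ Bz′y′) =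
      y≢ (Back-target-part Bz′y Bz′y′)
    no-opposite-backward y≢ z≢ y≺x Byx x≺z Bxz (fwd x≺y′ _) (fwd z′≺x _) (fwd _ _) (bwd _ Bzy′) (bwd _ Bz′y′) =
      z≢ (Back-source-part Bzy′ Bz′y′)
    no-opposite-backward y≢ z≢ y≺x Byx x≺z Bxz (fwd x≺y′ _) (fwd z′≺x _) (fwd y≺z′ _) (fwd y′≺z _) (bwd _ Bz′y′) =
      Back-no-crossing Byx Bxz Bz′y′ y≺z′ z′≺x x≺y′ y′≺z

    backward-sources-repeat : ∀ {x y y′ z} → Part y ≢ Part y′ →
                              x ≺ y → x ≺ y′ → z ≺ x → Arc y z → Arc y′ z → ⊥
    backward-sources-repeat y≢ x≺y x≺y′ z≺x (fwd y≺z _) _ = ≺-irrefl (≺-trans x≺y (≺-trans y≺z z≺x))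
    backward-sources-repeat y≢ x≺y x≺y′ z≺x (bwd _ _) (fwd y′≺z _) =
      ≺-irrefl (≺-trans x≺y′ (≺-trans y′≺z z≺x))
    backward-sources-repeat y≢ x≺y x≺y′ z≺x (bwd _ Bzy) (bwd _ Bzy′) = y≢ (Back-target-part Bzy Bzy′)

    backward-targets-repeat : ∀ {x y z z′} → Part z ≢ Part z′ →
                              x ≺ y → z ≺ x → z′ ≺ x → Arc y z → Arc y z′ → ⊥
    backward-targets-repeat z≢ x≺y z≺x z′≺x (fwd y≺z _) _ = ≺-irrefl (≺-trans x≺y (≺-trans y≺z z≺x))
    backward-targets-repeat z≢ x≺y z≺x z′≺x (bwd _ _) (fwd y≺z′ _) =
      ≺-irrefl (≺-trans x≺y (≺-trans y≺z′ z′≺x))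
    backward-targets-repeat z≢ x≺y z≺x z′≺x (bwd _ Bzy) (bwd _ Bz′y) = z≢ (Back-source-part Bzy Bz′y)

    -- At most one arc out of `x` and one arc into `x` are backward. If one side has none, a forward
    -- arc on the other side makes some vertex be selected from two parts or select in two parts.
    C₃-free : ∀ {x y y′ z z′} → Part y ≢ Part y′ → Part z ≢ Part z′ →
              Arc x y → Arc x y′ → Arc z x → Arc z′ x →
              Arc y z → Arc y z′ → Arc y′ z → Arc y′ z′ → ⊥
    C₃-free y≢ z≢ (bwd _ Byx) (bwd _ By′x) _ _ _ _ _ _ = y≢ (Back-source-part Byx By′x)
    C₃-free y≢ z≢ _ _ (bwd _ Bxz) (bwd _ Bxz′) _ _ _ _ = z≢ (Back-target-part Bxz Bxz′)
    C₃-free y≢ z≢ (fwd x≺y _) (fwd x≺y′ _) (fwd z≺x _) _ yz _ y′z _ =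
      backward-sources-repeat y≢ x≺y x≺y′ z≺x yz y′z
    C₃-free y≢ z≢ (fwd x≺y _) (fwd x≺y′ _) _ (fwd z′≺x _) _ yz′ _ y′z′ =
      backward-sources-repeat y≢ x≺y x≺y′ z′≺x yz′ y′z′
    C₃-free y≢ z≢ (fwd x≺y _) _ (fwd z≺x _) (fwd z′≺x _) yz yz′ _ _ =
      backward-targets-repeat z≢ x≺y z≺x z′≺x yz yz′
    C₃-free y≢ z≢ _ (fwd x≺y′ _) (fwd z≺x _) (fwd z′≺x _) _ _ y′z y′z′ =
      backward-targets-repeat z≢ x≺y′ z≺x z′≺x y′z y′z′
    C₃-free y≢ z≢ (bwd y≺x Byx) xy′@(fwd _ _) (bwd x≺z Bxz) z′x@(fwd _ _) _ yz′ y′z y′z′ =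
      no-opposite-backward y≢ z≢ y≺x Byx x≺z Bxz xy′ z′x yz′ y′z y′z′
    C₃-free y≢ z≢ (bwd y≺x Byx) xy′@(fwd _ _) zx@(fwd _ _) (bwd x≺z′ Bxz′) yz _ y′z y′z′ =
      no-opposite-backward y≢ (z≢ ∘ sym) y≺x Byx x≺z′ Bxz′ xy′ zx yz y′z′ y′z
    C₃-free y≢ z≢ xy@(fwd _ _) (bwd y′≺x By′x) (bwd x≺z Bxz) z′x@(fwd _ _) yz yz′ _ y′z′ =
      no-opposite-backward (y≢ ∘ sym) z≢ y′≺x By′x x≺z Bxz xy z′x y′z′ yz yz′
    C₃-free y≢ z≢ xy@(fwd _ _) (bwd y′≺x By′x) zx@(fwd _ _) (bwd x≺z′ Bxz′) yz yz′ y′z _ =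
      no-opposite-backward (y≢ ∘ sym) (z≢ ∘ sym) y′≺x By′x x≺z′ Bxz′ xy zx y′z yz′ yz

    -- Finite digraphs cut out by lists of vertices.

    digraph : List (List (Fin c)) → Digraph
    digraph vs = record { n = length vs ; arc = λ i j → does (lookup vs i ⟶? lookup vs j) }

    digraph-multipartite : ∀ vs → OrientedCompleteMultipartite (digraph vs)
    digraph-multipartite vs = suc m , p , λ i j → same i j , different i j
      where
      m = max 0 (map Part vs)

      bound : ∀ i → Part (lookup vs i) < suc m
      bound i = s≤s (All.lookup (xs≤max 0 (map Part vs)) (∈-map⁺ Part (∈-lookup {xs = vs} i)))

      p : Fin (length vs) → Fin (suc m)
      p i = fromℕ< (bound i)

      p-injective : ∀ i j → p i ≡ p j → Part (lookup vs i) ≡ Part (lookup vs j)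
      p-injective i j = Fin.fromℕ<-injective _ _ (bound i) (bound j)

      same : ∀ i j → p i ≡ p j → does (lookup vs i ⟶? lookup vs j) ≡ false
      same i j p≡ = dec-false (lookup vs i ⟶? lookup vs j) λ (p≢ , _) → p≢ (p-injective i j p≡)

      different : ∀ i j → p i ≢ p j →
        (arc (digraph vs) i j ≡ true × arc (digraph vs) j i ≡ false) ⊎
        (arc (digraph vs) i j ≡ false × arc (digraph vs) j i ≡ true)
      different i j p≢ = go (Arc-connex u v (P≢ ∘ cong Part))
        where
        u = lookup vs i
        v = lookup vs j
        P≢ : Part u ≢ Part v
        P≢ P≡ = p≢ (Fin.fromℕ<-cong _ _ P≡ (bound i) (bound j))
        go : Arc u v ⊎ Arc v u → _
        go (inj₁ a) = inj₁ (dec-true (u ⟶? v) (P≢ , a) , dec-false (v ⟶? u) (Arc-asym a ∘ proj₂))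
        go (inj₂ a) = inj₂ (dec-false (u ⟶? v) (Arc-asym a ∘ proj₂) , dec-true (v ⟶? u) (P≢ ∘ sym , a))

    digraph-arc⁻ : ∀ vs {i j} → arc (digraph vs) i j ≡ true → lookup vs i ⟶ lookup vs j
    digraph-arc⁻ vs {i} {j} = does-true (lookup vs i ⟶? lookup vs j)

    digraph-C₃-free : ∀ vs → ¬ ContainsInduced (digraph vs) (C⃗₃ (TT 1) (TT 2) (TT 2))
    digraph-C₃-free vs (φ , _ , φ-arc) =
      -- Here 0 is x, 1 and 2 are the yᵢ, 3 and 4 the zⱼ; the arcs y₁y₂ and z₁z₂ give the
      -- inequalities of parts.
      C₃-free (proj₁ (a 1F 2F refl)) (proj₁ (a 3F 4F refl))
        (proj₂ (a 0F 1F refl)) (proj₂ (a 0F 2F refl)) (proj₂ (a 3F 0F refl)) (proj₂ (a 4F 0F refl))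
        (proj₂ (a 1F 3F refl)) (proj₂ (a 1F 4F refl)) (proj₂ (a 2F 3F refl)) (proj₂ (a 2F 4F refl))
      where
      a : ∀ u v → arc (C⃗₃ (TT 1) (TT 2) (TT 2)) u v ≡ true → lookup vs (φ u) ⟶ lookup vs (φ v)
      a u v eq = digraph-arc⁻ vs (trans (sym (φ-arc u v)) eq)

    triangle : ∀ vs {u v w} → lookup vs u ⟶ lookup vs v → lookup vs v ⟶ lookup vs w →
               lookup vs w ⟶ lookup vs u → DirectedCycle (digraph vs)
    triangle vs {u} {v} {w} uv vw wu = record
      { len = 2 ; vtx = vtx′ ; inj = λ {i} {j} → inj′ i j ; step = step′ ; close = arc⁺ wu }
      where
      arc⁺ : ∀ {i j} → lookup vs i ⟶ lookup vs j → arc (digraph vs) i j ≡ true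
      arc⁺ {i} {j} = dec-true (lookup vs i ⟶? lookup vs j)

      ≢⁺ : ∀ {i j} → lookup vs i ⟶ lookup vs j → i ≢ j
      ≢⁺ (p≢ , _) refl = p≢ refl

      vtx′ : Fin 3 → Fin (length vs)
      vtx′ 0F = u
      vtx′ 1F = v
      vtx′ 2F = w

      step′ : ∀ i → arc (digraph vs) (vtx′ (inject₁ i)) (vtx′ (suc i)) ≡ true
      step′ 0F = arc⁺ uv
      step′ 1F = arc⁺ vw

      inj′ : ∀ i j → vtx′ i ≡ vtx′ j → i ≡ j
      inj′ 0F 0F _  = refl
      inj′ 0F 1F eq = ⊥-elim (≢⁺ uv eq)
      inj′ 0F 2F eq = ⊥-elim (≢⁺ wu (sym eq))
      inj′ 1F 0F eq = ⊥-elim (≢⁺ uv (sym eq))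
      inj′ 1F 1F _  = refl
      inj′ 1F 2F eq = ⊥-elim (≢⁺ vw eq)
      inj′ 2F 0F eq = ⊥-elim (≢⁺ wu eq)
      inj′ 2F 1F eq = ⊥-elim (≢⁺ vw (sym eq))
      inj′ 2F 2F _  = refl

  -- Histories and games.

  Entry : Set
  Entry = Label × Fin c

  History : Set
  History = List Entry

  -- Histories grow at the head while times count from the oldest entry, so growth preserves times.
  data At : History → ℕ → Entry → Set where
    here  : ∀ {e H} → At (e ∷ H) (length H) e
    there : ∀ {e e′ H t} → At H t e → At (e′ ∷ H) t e

  At⇒< : ∀ {H t e} → At H t e → t < length H
  At⇒< here      = ≤-refl
  At⇒< (there a) = m≤n⇒m≤1+n (At⇒< a)

  at-total : ∀ {H t} → t < length H → ∃ (At H t)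
  at-total {e ∷ H} {t} (s≤s t≤) with m≤n⇒m<n∨m≡n t≤
  ... | inj₁ t<    = _ , there (proj₂ (at-total t<))
  ... | inj₂ refl  = _ , here

  Alive : History → ℕ → ℕ → Set
  Alive H s t = ∀ {n e} → s < n → n < t → At H n e → s < base (proj₁ e)

  -- The arcs are r → s → t → r. By `lab-k≢l`, `s` does not select `r`; by `part-k≢l` and
  -- `target-m≡k`, `t` does not select `s`; the last four fields let `t` select `r`.
  record Triangle (H : History) : Set where
    field
      {r s t}    : ℕ
      {k l m}    : Label
      {γ}        : Fin c
      at-r       : At H r (k , γ)
      at-s       : At H s (l , γ)
      at-t       : At H t (m , γ)
      r<s        : r < s
      s<t        : s < t
      part-k≢l   : part k ≢ part l
      part-k≢m   : part k ≢ part m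
      part-l≢m   : part l ≢ part m
      lab-k≢l    : lab k ≢ part l
      lab-k≡m    : lab k ≡ part m
      target-m≡k : target m ≡ part k
      base≤      : base m ≤ r
      alive      : Alive H r t

  data Game (H : History) : Set where
    won  : Triangle H → Game H
    play : (l : Label) → (∀ γ → Game ((l , γ) ∷ H)) → Game H

  label : ∀ {H} → Game H → List (Fin c) → Label
  label (play l G) []      = l
  label (play l G) (γ ∷ v) = label (G γ) v
  -- A default: `nodes` lists only positions where a vertex is presented.
  label (won _)    _       = lbl 0 0 0 0

  nodes : ∀ {H} → Game H → List (List (Fin c))
  nodes (won _)    = []
  nodes (play l G) = [] ∷ concatMap (λ γ → map (γ ∷_) (nodes (G γ))) (allFin c)

  -- From a strategy to large dichromatic number.

  module _ (G₀ : Game []) where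

    open Multipartite (label G₀)

    vs : List (List (Fin c))
    vs = nodes G₀

    take-∷ʳ : ∀ (h : List (Fin c)) γ {t} → t ≤ length h → take t (h ∷ʳ γ) ≡ take t h
    take-∷ʳ h γ {zero} _ = refl
    take-∷ʳ (x ∷ h) γ {suc t} (s≤s t≤) = cong (x ∷_) (take-∷ʳ h γ t≤)

    Played : (Fin (length vs) → Fin c) → History → List (Fin c) → Set
    Played col H h = ∀ {t e} → At H t e →
      ∃ λ i → lookup vs i ≡ take t h × col i ≡ proj₂ e × label G₀ (take t h) ≡ proj₁ e

    MonoTriangle : (Fin (length vs) → Fin c) → Set
    MonoTriangle col = Σ (DirectedCycle (digraph vs)) λ C → Σ (Fin c) λ γ → ∀ i → col (vtx C i) ≡ γ

    mono-triangle : ∀ col {H} h → length h ≡ length H → Played col H h → Triangle H → MonoTriangle col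
    mono-triangle col {H} h len pl T = go (pl at-r) (pl at-s) (pl at-t)
      where
      open Triangle T
      t< : t < length h
      t< = subst (t <_) (sym len) (At⇒< at-t)
      u = take r h
      v = take s h
      w = take t h
      r<t = <-trans r<s s<t

      len-take : ∀ {n} → n ≤ t → length (take n h) ≡ n
      len-take n≤t = trans (List.length-take _ h) (m≤n⇒m⊓n≡m (≤-trans n≤t (<⇒≤ t<)))

      take-w : ∀ {n} → n ≤ t → take n w ≡ take n h
      take-w n≤t = trans (List.take-take _ t h) (cong (λ n → take n h) (m≤n⇒m⊓n≡m n≤t))

      label-take : ∀ {n e} → At H n e → label G₀ (take n h) ≡ proj₁ e
      label-take a = proj₂ (proj₂ (proj₂ (pl a)))

      part-u = cong part (label-take at-r)
      part-v = cong part (label-take at-s)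
      part-w = cong part (label-take at-t)
      lab-u  = cong lab (label-take at-r)

      u⟶v : u ⟶ v
      u⟶v = subst₂ _≢_ (sym part-u) (sym part-v) part-k≢l ,
        fwd (take-≺ r<s (<-trans r<t t<)) λ (_ , _ , _ , q , _) → lab-k≢l (trans (sym lab-u) (trans q part-v))

      v⟶w : v ⟶ w
      v⟶w = subst₂ _≢_ (sym part-v) (sym part-w) part-l≢m ,
        fwd (take-≺ s<t (<-trans s<t t<)) λ (_ , _ , p , _) → part-k≢l (trans (sym target-m≡k)
          (trans (sym (cong target (label-take at-t))) (trans (sym p) part-v)))

      w⟶u : w ⟶ u
      w⟶u = subst₂ _≢_ (sym part-w) (sym part-u) (part-k≢m ∘ sym) ,
        bwd (take-≺ r<t (<-trans r<t t<))
          ( sym (trans (cong (λ n → take n w) |u|) (take-w (<⇒≤ r<t)))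
          , subst₂ _<_ (sym |u|) (sym |w|) r<t
          , trans part-u (trans (sym target-m≡k) (sym (cong target (label-take at-t))))
          , trans lab-u (trans lab-k≡m (sym part-w))
          , subst₂ _≤_ (sym (cong base (label-take at-t))) (sym |u|) base≤
          , λ {n} n<w u<n → alive′ (subst (n <_) |w| n<w) (subst (_< n) |u| u<n))
        where
        |u| = len-take (<⇒≤ r<t)
        |w| = len-take ≤-refl
        alive′ : ∀ {n} → n < t → r < n → length u < base (label G₀ (take n w))
        alive′ n<t r<n with e , a ← at-total (<-trans n<t (At⇒< at-t)) =
          subst₂ _<_ (sym |u|)
            (cong base (sym (trans (cong (label G₀) (take-w (<⇒≤ n<t))) (label-take a)))) (alive r<n n<t a)

      go : (∃ λ i → lookup vs i ≡ u × col i ≡ γ × _) → (∃ λ j → lookup vs j ≡ v × col j ≡ γ × _) →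
           (∃ λ k → lookup vs k ≡ w × col k ≡ γ × _) → MonoTriangle col
      go (i , vi , ci , _) (j , vj , cj , _) (k , vk , ck , _) =
        triangle vs (subst₂ _⟶_ (sym vi) (sym vj) u⟶v) (subst₂ _⟶_ (sym vj) (sym vk) v⟶w)
                    (subst₂ _⟶_ (sym vk) (sym vi) w⟶u) ,
        γ , λ { 0F → ci ; 1F → cj ; 2F → ck }

    -- A colouring answers every move and so singles out a branch, which ends in a won position. The
    -- hypotheses on `h ++ v` identify `G` with the subtree of `G₀` at `h`.
    run : ∀ (col : Fin (length vs) → Fin c) {H} (G : Game H) h → length h ≡ length H →
          (∀ v → label G₀ (h ++ v) ≡ label G v) → (∀ {v} → v ∈ nodes G → h ++ v ∈ vs) →
          Played col H h → MonoTriangle col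
    run col (won T) h len lab≡ ⊆vs pl = mono-triangle col h len pl T
    run col {H} (play l G) h len lab≡ ⊆vs pl =
      run col (G γ) (h ∷ʳ γ) len′
        (λ v → trans (cong (label G₀) (List.++-assoc h (γ ∷ []) v)) (lab≡ (γ ∷ v)))
        (λ {v} v∈ → subst (_∈ vs) (sym (List.++-assoc h (γ ∷ []) v)) (⊆vs (child v∈)))
        played
      where
      h∈ : h ∈ vs
      h∈ = subst (_∈ vs) (List.++-identityʳ h) (⊆vs (Any.here refl))

      γ = col (index h∈)

      len′ : length (h ∷ʳ γ) ≡ suc (length H)
      len′ = trans (List.length-++-sucʳ h γ []) (cong suc (trans (cong length (List.++-identityʳ h)) len))

      child : ∀ {v} → v ∈ nodes (G γ) → γ ∷ v ∈ nodes (play l G)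
      child v∈ = Any.there (∈-concat⁺′ (∈-map⁺ (γ ∷_) v∈) (∈-map⁺ _ (∈-allFin γ)))

      prefix : ∀ {t} → t ≤ length H → take t (h ∷ʳ γ) ≡ take t h
      prefix t≤ = take-∷ʳ h γ (≤-trans t≤ (≤-reflexive (sym len)))

      played : Played col ((l , γ) ∷ H) (h ∷ʳ γ)
      played here =
        index h∈ , trans (sym (lookup-index h∈)) (sym whole) , refl ,
        trans (cong (label G₀) whole) (trans (cong (label G₀) (sym (List.++-identityʳ h))) (lab≡ []))
        where
        whole : take (length H) (h ∷ʳ γ) ≡ h
        whole = trans (prefix ≤-refl) (List.take-all (length H) h (≤-reflexive len))
      played (there a) with i , vi , ci , li ← pl a =
        i , trans vi (sym (prefix t≤)) , ci , trans (cong (label G₀) (prefix t≤)) li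
        where t≤ = <⇒≤ (At⇒< a)

    game⇒¬dichromatic : ¬ DichromaticAtMost (digraph vs) c
    game⇒¬dichromatic (col , acyclic)
      with C , mono ← run col G₀ [] refl (λ _ → refl) (λ v∈ → v∈) (λ ()) = acyclic C mono

  -- Growing histories and traps.

  data Ext (b : ℕ) (H : History) : History → Set where
    none : Ext b H H
    more : ∀ {H′ l γ} → b ≤ base l → Ext b H H′ → Ext b H ((l , γ) ∷ H′)

  Ext-trans : ∀ {b H H′ H″} → Ext b H H′ → Ext b H′ H″ → Ext b H H″
  Ext-trans p none        = p
  Ext-trans p (more b≤ q) = more b≤ (Ext-trans p q)

  Ext-weaken : ∀ {b b′ H H′} → b′ ≤ b → Ext b H H′ → Ext b′ H H′
  Ext-weaken b′≤b none        = none
  Ext-weaken b′≤b (more b≤ p) = more (≤-trans b′≤b b≤) (Ext-weaken b′≤b p)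

  Ext-length : ∀ {b H H′} → Ext b H H′ → length H ≤ length H′
  Ext-length none       = ≤-refl
  Ext-length (more _ p) = m≤n⇒m≤1+n (Ext-length p)

  Ext-at : ∀ {b H H′ t e} → Ext b H H′ → At H t e → At H′ t e
  Ext-at none       a = a
  Ext-at (more _ p) a = there (Ext-at p a)

  -- A vertex with base at least `b` pops nothing of time below `b`.
  Ext-alive : ∀ {b H H′ t} → Ext b H H′ → t < b → Alive H t (length H) → Alive H′ t (length H′)
  Ext-alive none        t<b al = al
  Ext-alive (more b≤ p) t<b al t<n n< here      = <-≤-trans t<b b≤
  Ext-alive (more b≤ p) t<b al t<n n< (there a) = Ext-alive p t<b al t<n (At⇒< a) a

  -- A new vertex of part q with target p that selects r closes a triangle if it receives colour γ.
  record Trap (H : History) (p q : ℕ) (γ : Fin c) (lo hi : ℕ) : Set where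
    field
      {r s}  : ℕ
      {k l}  : Label
      at-r   : At H r (k , γ)
      at-s   : At H s (l , γ)
      lo≤r   : lo ≤ r
      r<hi   : r < hi
      r<s    : r < s
      part≡  : part k ≡ p
      lab≡   : lab k ≡ q
      p≢     : p ≢ part l
      q≢     : q ≢ part l
      alive  : Alive H r (length H)

  Ext-trap : ∀ {b H H′ p q γ lo hi} → Ext b H H′ → hi ≤ b → Trap H p q γ lo hi → Trap H′ p q γ lo hi
  Ext-trap ext hi≤b T = record
    { Trap T
    ; at-r  = Ext-at ext (Trap.at-r T)
    ; at-s  = Ext-at ext (Trap.at-s T)
    ; alive = Ext-alive ext (<-≤-trans (Trap.r<hi T) hi≤b) (Trap.alive T)
    }

  trap-widen : ∀ {H p q γ lo hi lo′ hi′} → lo′ ≤ lo → hi ≤ hi′ → Trap H p q γ lo hi → Trap H p q γ lo′ hi′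
  trap-widen lo′≤ ≤hi′ T = record
    { Trap T ; lo≤r = ≤-trans lo′≤ (Trap.lo≤r T) ; r<hi = <-≤-trans (Trap.r<hi T) ≤hi′ }

  spring : ∀ {H p q γ lo hi i b} → p ≢ q → b ≤ lo → Trap H p q γ lo hi →
           Triangle ((lbl q i p b , γ) ∷ H)
  spring {H} {p} {q} {γ} p≢q b≤lo T = record
    { at-r = there at-r ; at-s = there at-s ; at-t = here
    ; r<s = r<s ; s<t = At⇒< at-s
    ; part-k≢l = subst (_≢ part l) (sym part≡) p≢
    ; part-k≢m = subst (_≢ q) (sym part≡) p≢q
    ; part-l≢m = q≢ ∘ sym
    ; lab-k≢l = subst (_≢ part l) (sym lab≡) q≢
    ; lab-k≡m = lab≡
    ; target-m≡k = sym part≡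
    ; base≤ = ≤-trans b≤lo lo≤r
    ; alive = λ { r<n n<t here → ⊥-elim (<-irrefl refl n<t) ; r<n n<t (there a) → alive r<n n<t a }
    }
    where open Trap T

  -- Builder's strategy against a set of colours.

  record Outside (A : Subset c) (N b : ℕ) (H : History) : Set where
    field
      {time}   : ℕ
      {place}  : Label
      {γ}      : Fin c
      at       : At H time (place , γ)
      b≤time   : b ≤ time
      N≤part   : N ≤ part place
      γ∉A      : γ ∉ₛ A

  -- The bound N keeps the part of the vertex reached apart from those of an enclosing game.
  ForceOutside : Subset c → ℕ → History → Set
  ForceOutside A N H = (∀ {H′} → Ext (length H) H H′ → Outside A N (length H) H′ → Game H′) → Game H

  module Stack
    (M : ℕ) (2^2^c<M : 2 ^ (2 ^ c) < M) (A : Subset c) (N : ℕ)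
    (forceOutside : ∀ {γ H} → γ ∈ₛ A → ForceOutside (A - γ) (N + M) H)
    {H₀ : History} (outside : ∀ {H} → Ext (length H₀) H₀ H → Outside A N (length H₀) H → Game H)
    where

    -- Part j of the header is part N + j, and combine i γ ∈ rows j encodes γ ∈ S j i.  The unpopped
    -- vertices of part j occupy the times from τ j up to τ (suc j), so base τ (suc j) pops exactly
    -- the parts above j.
    record State (J : ℕ) (H : History) : Set where
      field
        rows   : ℕ → Subset (M * c)
        τ      : ℕ → ℕ
        τ-mono : ∀ {j k} → j ≤ k → τ j ≤ τ k
        τ-bot  : length H₀ ≤ τ 0
        τ-top  : τ J ≤ length H
        ext    : Ext (length H₀) H₀ H
        traps  : ∀ {j} → j < J → ∀ (i : Fin M) γ → combine i γ ∈ₛ rows j →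
                 Trap H (N + j) (N + toℕ i) γ (τ j) (τ (suc j))

    -- The suspended loops of the levels below `J`: a new trap at level `j`, reached without popping
    -- anything at or below that level, resumes the loop there.
    Escape : ∀ {J H} → State J H → Set
    Escape {J} {H} S = ∀ {j} → j < J → ∀ (i : Fin M) γ → combine i γ ∉ₛ rows j →
                       ∀ {H′} → Ext (τ (suc j)) H H′ →
                       Trap H′ (N + j) (N + toℕ i) γ (τ j) (length H′) → Game H′
      where open State S

    H₀≤τ : ∀ {J H} (S : State J H) j → length H₀ ≤ State.τ S j
    H₀≤τ S j = ≤-trans (State.τ-bot S) (State.τ-mono S z≤n)

    extend : ∀ {J H H′} → Ext (length H) H H′ → State J H → State J H′
    extend e S = record
      { State S
      ; τ-top = ≤-trans (State.τ-top S) (Ext-length e)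
      ; ext   = Ext-trans (State.ext S) (Ext-weaken (Ext-length (State.ext S)) e)
      ; traps = λ j<J i γ x∈ → Ext-trap e (≤-trans (State.τ-mono S j<J) (State.τ-top S)) (State.traps S j<J i γ x∈)
      }

    extend-escape : ∀ {J H H′} (e : Ext (length H) H H′) (S : State J H) → Escape S → Escape (extend e S)
    extend-escape e S esc j<J i γ x∉ e′ =
      esc j<J i γ x∉ (Ext-trans (Ext-weaken (≤-trans (State.τ-mono S j<J) (State.τ-top S)) e) e′)

    module Push {J H} (S : State J H) (row : Subset (M * c))
                (traps-J : ∀ (i : Fin M) γ → combine i γ ∈ₛ row →
                           Trap H (N + J) (N + toℕ i) γ (State.τ S J) (length H))
                where
      open State S

      rows′ : ℕ → Subset (M * c)
      rows′ j with j ≟ J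
      ... | yes _ = row
      ... | no  _ = rows j

      τ′ : ℕ → ℕ
      τ′ j with j ≤? J
      ... | yes _ = τ j
      -- Higher levels are still empty, so they start at the end of the history.
      ... | no  _ = length H

      rows′-< : ∀ {j} → j < J → rows′ j ≡ rows j
      rows′-< {j} j<J with j ≟ J
      ... | yes refl = ⊥-elim (<-irrefl refl j<J)
      ... | no  _    = refl

      rows′-J : rows′ J ≡ row
      rows′-J with J ≟ J
      ... | yes _ = refl
      ... | no J≢ = ⊥-elim (J≢ refl)

      τ′-≤ : ∀ {j} → j ≤ J → τ′ j ≡ τ j
      τ′-≤ {j} j≤J with j ≤? J
      ... | yes _  = refl
      ... | no j≰J = ⊥-elim (j≰J j≤J)

      τ′-> : τ′ (suc J) ≡ length H
      τ′-> with suc J ≤? J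
      ... | yes J<J = ⊥-elim (<-irrefl refl J<J)
      ... | no  _   = refl

      τ′-mono : ∀ {j k} → j ≤ k → τ′ j ≤ τ′ k
      τ′-mono {j} {k} j≤k with j ≤? J | k ≤? J
      ... | yes _   | yes _   = τ-mono j≤k
      ... | yes j≤J | no  _   = ≤-trans (τ-mono j≤J) τ-top
      ... | no  j≰J | yes k≤J = ⊥-elim (j≰J (≤-trans j≤k k≤J))
      ... | no  _   | no  _   = ≤-refl

      traps′ : ∀ {j} → j < suc J → ∀ (i : Fin M) γ → combine i γ ∈ₛ rows′ j →
               Trap H (N + j) (N + toℕ i) γ (τ′ j) (τ′ (suc j))
      traps′ {j} (s≤s j≤J) i γ x∈ with m≤n⇒m<n∨m≡n j≤J
      ... | inj₁ j<J rewrite rows′-< j<J | τ′-≤ j≤J | τ′-≤ j<J = traps j<J i γ x∈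
      ... | inj₂ refl rewrite rows′-J | τ′-≤ j≤J | τ′-> = traps-J i γ x∈

      pushed : State (suc J) H
      pushed = record
        { rows = rows′ ; τ = τ′ ; τ-mono = τ′-mono
        ; τ-bot = subst (length H₀ ≤_) (sym (τ′-≤ z≤n)) τ-bot
        ; τ-top = ≤-reflexive τ′-> ; ext = ext ; traps = traps′ }

      escape-pushed : Escape S →
        (∀ (i : Fin M) γ → combine i γ ∉ₛ row → ∀ {H′} → Ext (length H) H H′ →
          Trap H′ (N + J) (N + toℕ i) γ (τ J) (length H′) → Game H′) →
        Escape pushed
      escape-pushed esc esc-J {j} (s≤s j≤J) i γ x∉ e T with m≤n⇒m<n∨m≡n j≤J
      ... | inj₁ j<J rewrite rows′-< j<J | τ′-≤ j≤J | τ′-≤ j<J = esc j<J i γ x∉ e T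
      ... | inj₂ refl rewrite rows′-J | τ′-≤ j≤J | τ′-> = esc-J i γ x∉ e T

    strike : ∀ {H} (S : State M H) → Escape S → Game H
    strike {H} S esc with monochromatic-path {M} {2 ^ c} 2^2^c<M
      (λ j i → code (λ γ → combine i γ Subset.∈? State.rows S (toℕ j)))
    ... | i , j , k , i<j , j<k , eq = play l move
      where
      open State S
      b = τ (suc (toℕ j))
      l = lbl (N + toℕ j) (N + toℕ i) (N + toℕ k) b

      move : ∀ γ → Game ((l , γ) ∷ H)
      move γ with combine j γ Subset.∈? rows (toℕ k) | γ Subset.∈? A
      -- As `j < k`, the base `τ (suc j)` is at most `τ k`, so the traps of part `k` are within
      -- reach.
      ... | yes x∈ | _ = won (spring (λ p≡ → <⇒≢ j<k (sym (+-cancelˡ-≡ N _ _ p≡))) (τ-mono j<k)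
                                     (traps (Fin.toℕ<n k) j γ x∈))
      ... | no x∉ | no γ∉A = outside (more (H₀≤τ S _) ext) (record
        { at = here ; b≤time = Ext-length ext ; N≤part = m≤m+n N _ ; γ∉A = γ∉A })
      ... | no x∉ | yes γ∈A = forceOutside γ∈A continue
        where
        H₁ = (l , γ) ∷ H

        continue : ∀ {H₂} → Ext (length H₁) H₁ H₂ → Outside (A - γ) (N + M) (length H₁) H₂ → Game H₂
        -- A colour outside `A - γ` is outside `A`, or it is `γ` repeated in a fresh part.
        continue e F with γ Fin.≟ Outside.γ F
        ... | no γ≢ = outside
          (Ext-trans ext (Ext-trans (more (H₀≤τ S _) none) (Ext-weaken (m≤n⇒m≤1+n (Ext-length ext)) e)))
          (record { at = Outside.at F ; b≤time = ≤-trans (m≤n⇒m≤1+n (Ext-length ext)) (Outside.b≤time F)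
                  ; N≤part = ≤-trans (m≤m+n N M) (Outside.N≤part F)
                  ; γ∉A = λ γ′∈A → Outside.γ∉A F (Subset.x∈p∧x≢y⇒x∈p-y γ′∈A (γ≢ ∘ sym)) })
        ... | yes refl = esc (Fin.toℕ<n j) i γ
          -- S j i equals S k j, which misses `γ`.
          (x∉ ∘ code-≡ _ _ (sym eq) γ)
          (Ext-trans (more ≤-refl none) (Ext-weaken (m≤n⇒m≤1+n b≤H) e))
          (record
            { at-r = Ext-at e here ; at-s = Outside.at F
            ; lo≤r = ≤-trans (τ-mono (n≤1+n _)) b≤H
            ; r<hi = Ext-length e ; r<s = Outside.b≤time F
            ; part≡ = refl ; lab≡ = refl
            ; p≢ = fresh j ; q≢ = fresh i
            ; alive = Ext-alive e ≤-refl λ { r<n n<t here → ⊥-elim (<-irrefl refl r<n)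
                                           ; r<n n<t (there a) → ⊥-elim (<-asym r<n (At⇒< a)) } })
          where
          b≤H : b ≤ length H
          b≤H = ≤-trans (τ-mono (Fin.toℕ<n j)) τ-top

          fresh : ∀ (i : Fin M) → N + toℕ i ≢ part (Outside.place F)
          fresh i = <⇒≢ (<-≤-trans (+-monoʳ-< N (Fin.toℕ<n i)) (Outside.N≤part F))

    mutual
      -- Lexicographic progress as nested recursion: `level` counts down the missing levels, `loop`
      -- enlarges the row of level `J`, and each enlargement rebuilds the higher levels from empty
      -- rows.
      level : ∀ m {J H} → J + m ≡ M → (S : State J H) → Escape S → Game H
      level zero    {J} J+0≡M S esc with refl ← trans (sym (+-identityʳ J)) J+0≡M = strike S esc
      level (suc m) J+m≡M S esc =
        loop m J+m≡M Subset.⊥ (⊃-wellFounded _) S esc (λ _ _ x∈ → ⊥-elim (Subset.∉⊥ x∈))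

      loop : ∀ m {J H} → J + suc m ≡ M → (row : Subset (M * c)) → Acc _⊃_ row →
             (S : State J H) → Escape S →
             (∀ (i : Fin M) γ → combine i γ ∈ₛ row →
               Trap H (N + J) (N + toℕ i) γ (State.τ S J) (length H)) → Game H
      loop m {J} J+m≡M row (acc rec) S esc traps =
        level m (trans (sym (+-suc J m)) J+m≡M) pushed (escape-pushed esc grow)
        where
        open Push S row traps
        grow : ∀ (i : Fin M) γ → combine i γ ∉ₛ row →
               ∀ {H′} → Ext _ _ H′ → Trap H′ _ _ γ _ (length H′) → Game H′
        grow i γ x∉ e T =
          loop m J+m≡M (row ∪ ⁅ x ⁆)
            (rec ((λ y∈ → Subset.p⊆p∪q _ y∈) , x , Subset.q⊆p∪q row _ (Subset.x∈⁅x⁆ x) , x∉))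
            (extend e S) (extend-escape e S esc) enlarged
          where
          x = combine i γ
          enlarged : ∀ (i′ : Fin M) γ′ → combine i′ γ′ ∈ₛ row ∪ ⁅ x ⁆ → Trap _ _ _ γ′ _ _
          enlarged i′ γ′ y∈ with Subset.x∈p∪q⁻ row ⁅ x ⁆ y∈
          -- The vertices added since have base at least the old length, so the old traps survive.
          ... | inj₁ y∈row = trap-widen ≤-refl (Ext-length e) (Ext-trap e ≤-refl (traps i′ γ′ y∈row))
          ... | inj₂ y∈x with refl , refl ← Fin.combine-injective i′ γ′ i γ (Subset.x∈⁅y⁆⇒x≡y x y∈x) = T

    start : Game H₀
    start = level M refl (record
      { rows = λ _ → Subset.⊥ ; τ = λ _ → length H₀ ; τ-mono = λ _ → ≤-refl
      ; τ-bot = ≤-refl ; τ-top = ≤-refl ; ext = none ; traps = λ () }) λ ()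

  -- Induction on the set of colours, and the conclusion.

  forceOutside : ∀ A → Acc _⊂_ A → ∀ N {H} → ForceOutside A N H
  forceOutside A (acc rec) N =
    Stack.start M ≤-refl A N λ {γ} γ∈A → forceOutside (A - γ) (rec (Subset.x∈p⇒p-x⊂p γ∈A)) (N + M)
    -- Sets of colours number `2 ^ c`, and families of such sets `2 ^ (2 ^ c)`.
    where M = suc (2 ^ (2 ^ c))

  -- No colour lies outside the full set, so the continuation is vacuous and every play ends in a
  -- triangle.
  game : Game []
  game = forceOutside Subset.⊤ (⊂-wellFounded _) 0 λ _ F → ⊥-elim (Outside.γ∉A F Subset.∈⊤)

theorem7p1p1 : ¬ Hero OrientedCompleteMultipartite (C⃗₃ (TT 1) (TT 2) (TT 2))
theorem7p1p1 (c , hero) = game⇒¬dichromatic G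
  (hero (digraph (vs G)) (digraph-multipartite (vs G)) (digraph-C₃-free (vs G)))
  where
  G = game {c}
  open Multipartite (label G)
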